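{- Let $G=(V,E)$ be a signed graph with no three distinct, pairwise non-adjacent vertices (i.e. the independence number $\alpha(G)$ is less than three). Then $G$ is signed-eliminable if and only if all of the following three conditions hold: (C2) For every $\sigma\in\{+,-\}$ and every four distinct vertices $u,v,w,x$ of $G$ with $uv\in E_\sigma$, $vw\in E_{ -\sigma}$, $wx\in E_\sigma$, we have either ($uw\in E_\sigma$ and $ux\in E_\sigma$) or ($ux\in E_\sigma$ and $vx\in E_\sigma$). (I1) Neither $G_+$ nor $G_-$ has a cycle of length four or five which is an induced cycle in $G$. (I2) $G$ contains no hill with five or six vertices as an induced subgraph.
   Context: All graphs are finite, simple and undirected. A signed graph is a graph $G=(V,E)$ together with a partition $E=E_+\sqcup E_-$ (either part may be empty); put $G_\sigma=(V,E_\sigma)$ for $\sigma\in\{+,-\}$, and let $-\sigma$ be the opposite sign. Induced subgraphs of a signed graph inherit the signs. An ordering on $G$ is a bijection $\nu:V\to\{1,\dots,|V|\}$. It is a signed elimination ordering (SEO) if for every triple $(u,v,w)$ of distinct vertices with $\nu(u)<\nu(w)>\nu(v)$ and each $\sigma\in\{+,-\}$: (E1) if $uw,wv\in E_\sigma$ then $uv\in E_\sigma$; (E2) if $uv\in E_\sigma$ and $vw\in E_{ -\sigma}$ then $uw\in E_\sigma$. $G$ is signed-eliminable if it admits a SEO. A hill is a signed graph for which there are $\sigma\in\{+,-\}$ and an enumeration $(v_1,\dots,v_n;w_1,w_2)$ of its (distinct) vertices, $n\ge 2$, such that $v_iv_{i+1}\in E_{ -\sigma}$ for $1\le i\le n-1$,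 $w_1w_2\in E_\sigma$, $w_1v_i\in E_\sigma$ for $1\le i\le n-1$, $w_2v_i\in E_\sigma$ for $2\le i\le n$, and no other pair of vertices is joined by an edge. -}

module Defs where

open import Data.Fin using (Fin; zero; suc; toℕ; _<_)
open import Data.List using ([]; _∷_)
open import Data.List.Relation.Unary.Unique.Propositional using (Unique)
open import Data.Nat as ℕ using (ℕ; suc)
open import Data.Product using (∃; ∃-syntax; _×_)
open import Data.Sign using (Sign; opposite)
open import Data.Sum using (_⊎_; inj₁; inj₂)
open import Function.Bundles using (_↔_; _↣_; Inverse; Injection)
open import Function.Construct.Identity using (↔-id)
open import Level using (0ℓ)
open import Relation.Binary.Core using (Rel)
open import Relation.Binary.Definitions using (Decidable; Symmetric)
open import Relation.Binary.PropositionalEquality using (_≡_)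
open import Relation.Nullary using (¬_)

-- E is decidable because finite graphs are classical objects, for which
-- adjacency can be tested; the theory here is constructive.
record SignedGraph : Set₁ where
  field
    V          : Set
    order      : ℕ
    finite     : V ↔ Fin order
    E          : Sign → Rel V 0ℓ
    E?         : ∀ σ → Decidable (E σ)
    E-sym      : ∀ σ → Symmetric (E σ)
    E-irrefl   : ∀ σ u → ¬ E σ u u
    E-disjoint : ∀ σ {u v} → E σ u v → ¬ E (opposite σ) u v

  Adj : Rel V 0ℓ
  Adj u v = ∃[ σ ] E σ u v

open SignedGraph

-- The induced signed subgraph on the image of f, its vertices renamed along f.
induced : (G : SignedGraph) {k : ℕ} → Fin k ↣ V G → SignedGraph
induced G {k} f = record
  { V          = Fin k
  ; order      = k
  ; finite     = ↔-id (Fin k)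
  ; E          = λ σ i j → E G σ (to i) (to j)
  ; E?         = λ σ i j → E? G σ (to i) (to j)
  ; E-sym      = λ σ → E-sym G σ
  ; E-irrefl   = λ σ i → E-irrefl G σ (to i)
  ; E-disjoint = λ σ → E-disjoint G σ
  }
  where open Injection f using (to)

-- Positions are counted from 0 rather than from 1.
Ordering : SignedGraph → Set
Ordering G = V G ↔ Fin (order G)

record IsSEO (G : SignedGraph) (ν : Ordering G) : Set where
  open Inverse ν using () renaming (to to pos)
  field
    E1 : ∀ σ u v w → Unique (u ∷ v ∷ w ∷ []) → pos u < pos w → pos v < pos w →
         E G σ u w → E G σ w v → E G σ u v
    E2 : ∀ σ u v w → Unique (u ∷ v ∷ w ∷ []) → pos u < pos w → pos v < pos w →
         E G σ u v → E G (opposite σ) v w → E G σ u w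

SignedEliminable : SignedGraph → Set
SignedEliminable G = ∃ λ (ν : Ordering G) → IsSEO G ν

NoIndependentTriple : SignedGraph → Set
NoIndependentTriple G = ∀ u v w → Unique (u ∷ v ∷ w ∷ []) →
  ¬ (¬ Adj G u v × ¬ Adj G u w × ¬ Adj G v w)

C2 : SignedGraph → Set
C2 G = ∀ σ u v w x → Unique (u ∷ v ∷ w ∷ x ∷ []) →
  E G σ u v → E G (opposite σ) v w → E G σ w x →
  (E G σ u w × E G σ u x) ⊎ (E G σ u x × E G σ v x)

Next : {k : ℕ} → Rel (Fin k) 0ℓ
Next i j = toℕ j ≡ suc (toℕ i)

CyclicNext : {k : ℕ} → Rel (Fin k) 0ℓ
CyclicNext {k} i j = Next i j ⊎ (suc (toℕ i) ≡ k × toℕ j ≡ 0)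

record IsCycle {A : Set} (R : Rel A 0ℓ) {k : ℕ} (c : Fin k ↣ A) : Set where
  open Injection c using (to)
  field
    length≥3 : 3 ℕ.≤ k
    edges    : ∀ i j → CyclicNext i j → R (to i) (to j)

record IsInducedCycle {A : Set} (R : Rel A 0ℓ) {k : ℕ} (c : Fin k ↣ A) : Set where
  open Injection c using (to)
  field
    isCycle   : IsCycle R c
    chordless : ∀ i j → R (to i) (to j) → CyclicNext i j ⊎ CyclicNext j i

I1 : SignedGraph → Set
I1 G = ∀ σ k → k ≡ 4 ⊎ k ≡ 5 → (c : Fin k ↣ V G) →
  ¬ (IsCycle (E G σ) c × IsInducedCycle (Adj G) c)

-- In 1-based notation v i is v_{i+1}; thus suc (toℕ i) < n excludes only v_n,
-- and 0 < toℕ i excludes only v_1.  The last three fields say that there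
-- are no other edges (w₁ and w₂ are adjacent by w₁w₂).
record Hill (G : SignedGraph) : Set where
  field
    σ           : Sign
    n           : ℕ
    n≥2         : 2 ℕ.≤ n
    enumeration : (Fin n ⊎ Fin 2) ↔ V G

  open Inverse enumeration using (to)

  v : Fin n → V G
  v i = to (inj₁ i)

  w₁ : V G
  w₁ = to (inj₂ zero)

  w₂ : V G
  w₂ = to (inj₂ (suc zero))

  field
    vv       : ∀ i j → Next i j → E G (opposite σ) (v i) (v j)
    w₁w₂     : E G σ w₁ w₂
    w₁v      : ∀ i → suc (toℕ i) ℕ.< n → E G σ w₁ (v i)
    w₂v      : ∀ i → 0 ℕ.< toℕ i → E G σ w₂ (v i)
    vv-only  : ∀ i j → Adj G (v i) (v j) → Next i j ⊎ Next j i
    w₁v-only : ∀ i → Adj G w₁ (v i) → suc (toℕ i) ℕ.< n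
    w₂v-only : ∀ i → Adj G w₂ (v i) → 0 ℕ.< toℕ i

I2 : SignedGraph → Set
I2 G = ∀ k → k ≡ 5 ⊎ k ≡ 6 → (f : Fin k ↣ V G) → ¬ Hill (induced G f)

{-# OPTIONS --safe #-}

-- By induction it suffices to find a vertex that can be put last, i.e. a w such
-- that each N_σ(w) is a σ-clique and N_σ(v) ⊆ N_σ(w) whenever vw has sign −σ.
-- Condition C2 says that the σ-neighbourhoods of the ends of a −σ-edge are
-- nested, the smaller one being a σ-clique joined by σ to the larger one. Hence
-- "sinks", the vertices with the second property, exist.
--
-- Let y be a sink which is not good, σ a sign for which K = N_σ(y) is not a
-- clique, M = N_−σ(y), and Z the set of non-neighbours of y. Then K has no
-- −σ-edges, M and Z are cliques, Z is joined to K by σ-edges only and to M by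
-- −σ-edges only. As in Dirac's theorem K contains two non-adjacent simplicial
-- vertices a, b. Excluding C4, C5 and the hill on five vertices, one of a and b
-- is joined to all of Z and the other to none of it, and one of them is joined
-- to all of M. If b misses Z and is joined to all of M, then b is good.
-- Otherwise b misses Z and part of M, the hill on six vertices forces Z and M
-- to be completely joined, and a sink of Z whose neighbourhood in K is minimal
-- is good.
module Submission where

open import Defs
open import Data.Bool using (T)
open import Data.Empty using (⊥; ⊥-elim)
open import Data.Fin using (Fin; zero; suc; toℕ; fromℕ; fromℕ<; inject₁; punchIn; punchOut; _<_)
open import Data.Fin.Patterns using (0F; 1F; 2F; 3F; 4F)
import Data.Fin.Permutation as Permutation
import Data.Fin.Properties as Fin
open import Data.List using ([]; _∷_; tabulate)
open import Data.List.Relation.Unary.All as All using (All; []; _∷_)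
open import Data.List.Relation.Unary.All.Properties using (tabulate⁻)
open import Data.List.Relation.Unary.AllPairs using ([]; _∷_)
open import Data.List.Relation.Unary.Unique.Propositional using () renaming (Unique to List-Unique)
open import Data.List.Relation.Unary.Unique.Propositional.Properties using () renaming (map⁺ to Unique-map⁺)
open import Data.Nat as ℕ using (ℕ; zero; suc; z≤n; s≤s)
import Data.Nat.Properties as ℕ
open import Data.Product using (∃; _×_; _,_; proj₁; proj₂; map₂)
open import Data.Sign using (Sign; opposite; +; -)
open import Data.Sign.Properties using (opposite-involutive)
open import Data.Sum using (_⊎_; inj₁; inj₂; [_,_]′; swap)
open import Data.Sum.Properties using (inj₁-injective)
open import Data.Vec using (Vec; []; _∷_; lookup)
open import Data.Vec.Relation.Unary.All using ([]; _∷_)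
open import Data.Vec.Relation.Unary.AllPairs using ([]; _∷_)
import Data.Vec.Relation.Unary.Unique.Propositional as Vec
open import Data.Vec.Relation.Unary.Unique.Propositional.Properties using (lookup-injective)
open import Function using (_∘_; id; _on_)
open import Function.Bundles using (_↔_; _↣_; _⇔_; Inverse; Injection; mk⇔; mk↣)
open import Function.Construct.Composition using (_↔-∘_; _↣-∘_)
open import Function.Construct.Identity using (↔-id)
open import Function.Construct.Symmetry using (↔-sym)
open import Function.Properties.Inverse using (↔⇒↣)
open import Level using (0ℓ)
open import Relation.Binary.Core using (Rel)
open import Relation.Binary.Definitions using (DecidableEquality; Transitive; tri<; tri≈; tri>)
import Relation.Binary.Definitions as Binary
open import Relation.Binary.PropositionalEquality
  using (_≡_; _≢_; refl; sym; trans; cong; subst; subst₂; ≢-sym)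
open import Relation.Nullary using (¬_; Dec; yes; no; contradiction)
open import Relation.Nullary.Decidable
  using (False; map′; toWitnessFalse; ¬?; _×-dec_; _⊎-dec_; _→-dec_; decidable-stable)
open import Relation.Unary using (Pred; Decidable; _⊆_; _⊂_; U)
open import Relation.Unary.Properties using (⊂-trans; U?)

-- Finite search, extremal elements and signs.

module Finite {A : Set} {n : ℕ} (fin : A ↔ Fin n) where
  open Inverse fin using (to; from; strictlyInverseʳ)

  infix 4 _≟_

  _≟_ : DecidableEquality A
  _≟_ = Fin.inj⇒≟ (↔⇒↣ fin)

  any? : {P : Pred A 0ℓ} → Decidable P → Dec (∃ P)
  any? {P} P? = map′ (λ (i , p) → from i , p)
    (λ (x , p) → to x , subst P (sym (strictlyInverseʳ x)) p) (Fin.any? (P? ∘ from))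

  all? : {P : Pred A 0ℓ} → Decidable P → Dec (∀ x → P x)
  all? {P} P? = map′ (λ f x → subst P (strictlyInverseʳ x) (f (to x))) (_∘ from)
    (Fin.all? (P? ∘ from))

  _⊆?_ : {P Q : Pred A 0ℓ} → Decidable P → Decidable Q → Dec (P ⊆ Q)
  P? ⊆? Q? = map′ (λ f {x} → f x) (λ f x → f {x}) (all? λ x → P? x →-dec Q? x)

  _⊂?_ : {P Q : Pred A 0ℓ} → Decidable P → Decidable Q → Dec (P ⊂ Q)
  P? ⊂? Q? = (P? ⊆? Q?) ×-dec ¬? (Q? ⊆? P?)

  ⊈⇒∃ : {P Q : Pred A 0ℓ} → Decidable P → Decidable Q → ¬ P ⊆ Q → ∃ λ x → P x × ¬ Q x
  ⊈⇒∃ P? Q? P⊈Q with any? (λ x → P? x ×-dec ¬? (Q? x))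
  ... | yes w = w
  ... | no ¬w = contradiction
    (λ {x} p → decidable-stable (Q? x) λ ¬q → ¬w (x , p , ¬q)) P⊈Q

  module _ {S : Pred A 0ℓ} (S? : Decidable S) {_<_ : Rel A 0ℓ} (_<?_ : Binary.Decidable _<_)
           (<-trans : Transitive _<_) (<-irrefl : ∀ {x} → ¬ x < x) where

    private
      -- The given element of `S` is the starting value, so `z` need not occur in `xs`.
      maximalIn : ∀ xs → ∃ S → ∃ λ z → S z × All (λ w → S w → ¬ z < w) xs
      maximalIn []       (z , Sz) = z , Sz , []
      maximalIn (x ∷ xs) ∃S with maximalIn xs ∃S
      ... | z , Sz , max with S? x ×-dec (z <? x)
      ...   | no ¬x       = z , Sz , (λ Sx z<x → ¬x (Sx , z<x)) ∷ max
      ...   | yes (Sx , z<x) = x , Sx , (λ _ → <-irrefl) ∷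
        All.map (λ f Sw x<w → f Sw (<-trans z<x x<w)) max

    maximal : ∃ S → ∃ λ z → S z × (∀ w → S w → ¬ z < w)
    maximal ∃S with maximalIn (tabulate from) ∃S
    ... | z , Sz , max = z , Sz ,
      λ w → subst (λ w → S w → ¬ z < w) (strictlyInverseʳ w) (tabulate⁻ max (to w))

  module _ {S : Pred A 0ℓ} (S? : Decidable S)
           {F : A → Pred A 0ℓ} (F? : ∀ x → Decidable (F x)) where

    ⊂-maximal : ∃ S → ∃ λ z → S z × (∀ w → S w → ¬ F z ⊂ F w)
    ⊂-maximal = maximal S? (λ x y → F? x ⊂? F? y)
      (λ {x} {y} {z} → ⊂-trans {i = F x} {F y} {F z}) (λ (⊆ , ⊈) → ⊈ ⊆)

    ⊂-minimal : ∃ S → ∃ λ z → S z × (∀ w → S w → ¬ F w ⊂ F z)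
    ⊂-minimal = maximal S? (λ x y → F? y ⊂? F? x)
      (λ {x} {y} {z} p q → ⊂-trans {i = F z} {F y} {F x} q p) (λ (⊆ , ⊈) → ⊈ ⊆)

-- A relation between two sign variables, so that a lemma can also be used with σ and τ exchanged
-- although `opposite (opposite σ)` does not reduce to σ.
Opp : Rel Sign 0ℓ
Opp σ τ = τ ≡ opposite σ

opp-sym : ∀ {σ τ} → Opp σ τ → Opp τ σ
opp-sym {σ} refl = sym (opposite-involutive σ)

sign-cases : ∀ {σ τ} → Opp σ τ → ∀ ρ → ρ ≡ σ ⊎ ρ ≡ τ
sign-cases { + } refl + = inj₁ refl
sign-cases { + } refl - = inj₂ refl
sign-cases { - } refl + = inj₂ refl
sign-cases { - } refl - = inj₁ refl

-- `Good` and `SinkIn` quantify over all signs, while the structure around a sink singles out one σ;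
-- this reduces the former to the two cases σ and τ.
by-sign : ∀ {σ τ} → Opp σ τ → (P : Rel Sign 0ℓ) → P σ τ → P τ σ → ∀ {ρ ρ′} → Opp ρ ρ′ → P ρ ρ′
by-sign { + } refl P p q { + } refl = p
by-sign { + } refl P p q { - } refl = q
by-sign { - } refl P p q { + } refl = q
by-sign { - } refl P p q { - } refl = p

tuple : {A : Set} {n : ℕ} {xs : Vec A n} → Vec.Unique xs → Fin n ↣ A
tuple {xs = xs} u = mk↣ {to = lookup xs} (lookup-injective u _ _)

-- Good vertices and adjacency.

record Good (G : SignedGraph) (w : SignedGraph.V G) : Set where
  open SignedGraph G
  field
    simplicial : ∀ σ u v → u ≢ v → E σ u w → E σ w v → E σ u v
    dominating : ∀ {σ τ} u v → Opp σ τ → E σ u v → E τ v w → E σ u w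

module Links (G : SignedGraph) where
  open SignedGraph G
  open Finite finite public

  Far : Rel V 0ℓ
  Far u v = u ≢ v × ¬ Adj u v

  N : Sign → V → Pred V 0ℓ
  N σ v t = E σ t v

  N? : ∀ σ v → Decidable (N σ v)
  N? σ v t = E? σ t v

  E↔ : ∀ {σ u v} → E σ u v → E σ v u
  E↔ {σ} = E-sym σ

  E⇒≢ : ∀ {σ u v} → E σ u v → u ≢ v
  E⇒≢ {σ} e refl = E-irrefl σ _ e

  disjoint : ∀ {σ τ u v} → Opp σ τ → E σ u v → ¬ E τ u v
  disjoint {σ} refl = E-disjoint σ

  far-sym : ∀ {u v} → Far u v → Far v u
  far-sym (u≢v , ¬uv) = ≢-sym u≢v , λ (σ , e) → ¬uv (σ , E↔ e)

  far⇒¬E : ∀ {σ u v} → Far u v → ¬ E σ u v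
  far⇒¬E (_ , ¬uv) e = ¬uv (_ , e)

  far : ∀ {σ τ u v} → Opp σ τ → u ≢ v → ¬ E σ u v → ¬ E τ u v → Far u v
  far {σ} {τ} {u} {v} op u≢v ¬σ ¬τ = u≢v , λ (ρ , e) →
    [ (λ { refl → ¬σ e }) , (λ { refl → ¬τ e }) ]′ (sign-cases op ρ)

  link : ∀ {σ τ u v} → Opp σ τ → u ≢ v → E σ u v ⊎ E τ u v ⊎ Far u v
  link {σ} {τ} {u} {v} op u≢v with E? σ u v | E? τ u v
  ... | yes e | _     = inj₁ e
  ... | no _  | yes e = inj₂ (inj₁ e)
  ... | no ¬σ | no ¬τ = inj₂ (inj₂ (far op u≢v ¬σ ¬τ))

  far? : Binary.Decidable Far
  far? u v with u ≟ v
  ... | yes refl = no λ (u≢u , _) → u≢u refl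
  ... | no u≢v with E? + u v | E? - u v
  ...   | yes e | _     = no λ f → far⇒¬E f e
  ...   | no _  | yes e = no λ f → far⇒¬E f e
  ...   | no ¬p | no ¬m = yes (far refl u≢v ¬p ¬m)

-- Consequences of C2, I1 and I2.

module Conditions (G : SignedGraph) (α : NoIndependentTriple G)
                  (c2 : C2 G) (i1 : I1 G) (i2 : I2 G) where
  open SignedGraph G
  open Links G

  no-far-triple : ∀ {u v w} → Far u v → Far u w → Far v w → ⊥
  no-far-triple (u≢v , uv) (u≢w , uw) (v≢w , vw) =
    α _ _ _ ((u≢v ∷ u≢w ∷ []) ∷ (v≢w ∷ []) ∷ [] ∷ []) (uv , uw , vw)

  -- The rest of the distinctness in C2 is automatic: `u = w` or `v = x` would give one pair both
  -- signs.
  path : ∀ {σ τ u v w x} → Opp σ τ → u ≢ x → E σ u v → E τ v w → E σ w x →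
         (E σ u w × E σ u x) ⊎ (E σ u x × E σ v x)
  path {σ} refl u≢x uv vw wx = c2 σ _ _ _ _
    ((E⇒≢ uv ∷ (λ { refl → disjoint refl (E↔ uv) vw }) ∷ u≢x ∷ []) ∷
     (E⇒≢ vw ∷ (λ { refl → disjoint refl (E↔ wx) vw }) ∷ []) ∷
     (E⇒≢ wx ∷ []) ∷ [] ∷ [])
    uv vw wx

  path⇒ends : ∀ {σ τ u v w x} → Opp σ τ → u ≢ x → E σ u v → E τ v w → E σ w x → E σ u x
  path⇒ends op u≢x uv vw wx = [ proj₂ , proj₁ ]′ (path op u≢x uv vw wx)

  -- C2 applies to the path `t v w x`. Its second alternative contains the excluded edge `vx`, so
  -- the first one holds and gives `tw`.
  nested : ∀ {σ τ v w x} → Opp σ τ → E τ v w → E σ x w → ¬ E σ x v → N σ v ⊆ N σ w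
  nested op vw xw ¬xv {t} tv =
    [ proj₁ , (λ (_ , vx) → contradiction (E↔ vx) ¬xv) ]′
      (path op (λ { refl → ¬xv tv }) tv vw (E↔ xw))

  -- T (m <ᵇ n) rather than m < n makes the cases i ≥ j vanish by computation.
  adjacent-only : ∀ {k} {f : Fin k → V} {P : Rel (Fin k) 0ℓ} → (∀ {i j} → P i j → P j i) →
                  (∀ i j → T (toℕ i ℕ.<ᵇ toℕ j) → P i j ⊎ ¬ Adj (f i) (f j)) →
                  ∀ i j → Adj (f i) (f j) → P i j
  adjacent-only P-sym h i j (σ , e) with Fin.<-cmp i j
  ... | tri< i<j _ _ = [ id , contradiction (σ , e) ]′ (h i j (ℕ.<⇒<ᵇ i<j))
  ... | tri≈ _ refl _ = contradiction refl (E⇒≢ e)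
  ... | tri> _ _ j<i = P-sym ([ id , contradiction (σ , E↔ e) ]′ (h j i (ℕ.<⇒<ᵇ j<i)))

  no-C4 : ∀ {σ a b c d} → E σ a b → E σ b c → E σ c d → E σ d a → Far a c → Far b d → ⊥
  no-C4 {σ} {a} {b} {c} {d} ab bc cd da ac bd =
    i1 σ 4 (inj₁ refl) f
      (cycle (E σ) id , record { isCycle = cycle Adj (σ ,_) ; chordless = adjacent-only swap chords })
    where
    vertices : Vec V 4
    vertices = a ∷ b ∷ c ∷ d ∷ []

    f : Fin 4 ↣ V
    f = tuple {xs = vertices}
      ((E⇒≢ ab ∷ proj₁ ac ∷ E⇒≢ (E↔ da) ∷ []) ∷ (E⇒≢ bc ∷ proj₁ bd ∷ []) ∷ (E⇒≢ cd ∷ []) ∷ [] ∷ [])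

    cycle : (R : Rel V 0ℓ) → (∀ {u v} → E σ u v → R u v) → IsCycle R f
    cycle R r = record
      { length≥3 = s≤s (s≤s (s≤s z≤n))
      ; edges    = λ { i j (inj₁ n) → step i j n ; i j (inj₂ (p , q)) → close i j p q }
      }
      where
      step : ∀ i j → Next i j → R (lookup vertices i) (lookup vertices j)
      step 0F 1F refl = r ab
      step 1F 2F refl = r bc
      step 2F 3F refl = r cd

      close : ∀ i j → suc (toℕ i) ≡ 4 → toℕ j ≡ 0 → R (lookup vertices i) (lookup vertices j)
      close 3F 0F refl refl = r da

    chords : ∀ i j → T (toℕ i ℕ.<ᵇ toℕ j) →
             (CyclicNext i j ⊎ CyclicNext j i) ⊎ ¬ Adj (lookup vertices i) (lookup vertices j)
    chords 0F 1F _ = inj₁ (inj₁ (inj₁ refl))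
    chords 0F 2F _ = inj₂ (proj₂ ac)
    chords 0F 3F _ = inj₁ (inj₂ (inj₂ (refl , refl)))
    chords 1F 2F _ = inj₁ (inj₁ (inj₁ refl))
    chords 1F 3F _ = inj₂ (proj₂ bd)
    chords 2F 3F _ = inj₁ (inj₁ (inj₁ refl))

  no-C5 : ∀ {σ a b c d e} → E σ a b → E σ b c → E σ c d → E σ d e → E σ e a →
          Far a c → Far a d → Far b d → Far b e → Far c e → ⊥
  no-C5 {σ} {a} {b} {c} {d} {e} ab bc cd de ea ac ad bd be ce =
    i1 σ 5 (inj₂ refl) f
      (cycle (E σ) id , record { isCycle = cycle Adj (σ ,_) ; chordless = adjacent-only swap chords })
    where
    vertices : Vec V 5
    vertices = a ∷ b ∷ c ∷ d ∷ e ∷ []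

    f : Fin 5 ↣ V
    f = tuple {xs = vertices}
      ((E⇒≢ ab ∷ proj₁ ac ∷ proj₁ ad ∷ E⇒≢ (E↔ ea) ∷ []) ∷ (E⇒≢ bc ∷ proj₁ bd ∷ proj₁ be ∷ []) ∷
       (E⇒≢ cd ∷ proj₁ ce ∷ []) ∷ (E⇒≢ de ∷ []) ∷ [] ∷ [])

    cycle : (R : Rel V 0ℓ) → (∀ {u v} → E σ u v → R u v) → IsCycle R f
    cycle R r = record
      { length≥3 = s≤s (s≤s (s≤s z≤n))
      ; edges    = λ { i j (inj₁ n) → step i j n ; i j (inj₂ (p , q)) → close i j p q }
      }
      where
      step : ∀ i j → Next i j → R (lookup vertices i) (lookup vertices j)
      step 0F 1F refl = r ab
      step 1F 2F refl = r bc
      step 2F 3F refl = r cd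
      step 3F 4F refl = r de

      close : ∀ i j → suc (toℕ i) ≡ 5 → toℕ j ≡ 0 → R (lookup vertices i) (lookup vertices j)
      close 4F 0F refl refl = r ea

    chords : ∀ i j → T (toℕ i ℕ.<ᵇ toℕ j) →
             (CyclicNext i j ⊎ CyclicNext j i) ⊎ ¬ Adj (lookup vertices i) (lookup vertices j)
    chords 0F 1F _ = inj₁ (inj₁ (inj₁ refl))
    chords 0F 2F _ = inj₂ (proj₂ ac)
    chords 0F 3F _ = inj₂ (proj₂ ad)
    chords 0F 4F _ = inj₁ (inj₂ (inj₂ (refl , refl)))
    chords 1F 2F _ = inj₁ (inj₁ (inj₁ refl))
    chords 1F 3F _ = inj₂ (proj₂ bd)
    chords 1F 4F _ = inj₂ (proj₂ be)
    chords 2F 3F _ = inj₁ (inj₁ (inj₁ refl))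
    chords 2F 4F _ = inj₂ (proj₂ ce)
    chords 3F 4F _ = inj₁ (inj₁ (inj₁ refl))

  no-hill₅ : ∀ {σ τ a b c w x} → Opp σ τ → E τ a b → E τ b c → Far a c →
             E σ w x → E σ w a → E σ w b → Far w c → Far x a → E σ x b → E σ x c → ⊥
  no-hill₅ {σ} {τ} {a} {b} {c} {w} {x} refl ab bc ac wx wa wb wc xa xb xc =
    i2 5 (inj₁ refl) f record
      -- The tuple lists the path first, so `+↔⊎` splits it into `a b c`, the path of the hill, and
      -- the pair `w`, `x`.
      { σ = σ ; n = 3 ; n≥2 = s≤s (s≤s z≤n) ; enumeration = ↔-sym Fin.+↔⊎
      ; vv = vv ; w₁w₂ = wx ; w₁v = w₁v ; w₂v = w₂v
      ; vv-only = adjacent-only swap vv-only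
      ; w₁v-only = w₁v-only
      ; w₂v-only = w₂v-only
      }
    where
    vertices : Vec V 3
    vertices = a ∷ b ∷ c ∷ []

    f : Fin 5 ↣ V
    f = tuple {xs = a ∷ b ∷ c ∷ w ∷ x ∷ []}
      ((E⇒≢ ab ∷ proj₁ ac ∷ E⇒≢ (E↔ wa) ∷ proj₁ (far-sym xa) ∷ []) ∷
       (E⇒≢ bc ∷ E⇒≢ (E↔ wb) ∷ E⇒≢ (E↔ xb) ∷ []) ∷
       (proj₁ (far-sym wc) ∷ E⇒≢ (E↔ xc) ∷ []) ∷ (E⇒≢ wx ∷ []) ∷ [] ∷ [])

    v : Fin 3 → V
    v i = Injection.to f (Inverse.from Fin.+↔⊎ (inj₁ i))

    vv : ∀ i j → Next i j → E τ (v i) (v j)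
    vv 0F 1F refl = ab
    vv 1F 2F refl = bc

    w₁v : ∀ i → suc (toℕ i) ℕ.< 3 → E σ w (v i)
    w₁v 0F _ = wa
    w₁v 1F _ = wb
    w₁v 2F (s≤s (s≤s (s≤s ())))

    w₂v : ∀ i → 0 ℕ.< toℕ i → E σ x (v i)
    w₂v 1F _ = xb
    w₂v 2F _ = xc

    vv-only : ∀ i j → T (toℕ i ℕ.<ᵇ toℕ j) → (Next i j ⊎ Next j i) ⊎ ¬ Adj (v i) (v j)
    vv-only 0F 1F _ = inj₁ (inj₁ refl)
    vv-only 0F 2F _ = inj₂ (proj₂ ac)
    vv-only 1F 2F _ = inj₁ (inj₁ refl)

    w₁v-only : ∀ i → Adj w (v i) → suc (toℕ i) ℕ.< 3
    w₁v-only 0F _ = s≤s (s≤s z≤n)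
    w₁v-only 1F _ = s≤s (s≤s (s≤s z≤n))
    w₁v-only 2F e = contradiction e (proj₂ wc)

    w₂v-only : ∀ i → Adj x (v i) → 0 ℕ.< toℕ i
    w₂v-only 0F e = contradiction e (proj₂ xa)
    w₂v-only 1F _ = s≤s z≤n
    w₂v-only 2F _ = s≤s z≤n

  no-hill₆ : ∀ {σ τ a b c d w x} → Opp σ τ → E τ a b → E τ b c → E τ c d →
             Far a c → Far a d → Far b d → E σ w x →
             E σ w a → E σ w b → E σ w c → Far w d →
             Far x a → E σ x b → E σ x c → E σ x d → ⊥
  no-hill₆ {σ} {τ} {a} {b} {c} {d} {w} {x} refl ab bc cd ac ad bd wx wa wb wc wd xa xb xc xd =
    i2 6 (inj₂ refl) f record
      { σ = σ ; n = 4 ; n≥2 = s≤s (s≤s z≤n) ; enumeration = ↔-sym Fin.+↔⊎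
      ; vv = vv ; w₁w₂ = wx ; w₁v = w₁v ; w₂v = w₂v
      ; vv-only = adjacent-only swap vv-only
      ; w₁v-only = w₁v-only
      ; w₂v-only = w₂v-only
      }
    where
    f : Fin 6 ↣ V
    f = tuple {xs = a ∷ b ∷ c ∷ d ∷ w ∷ x ∷ []}
      ((E⇒≢ ab ∷ proj₁ ac ∷ proj₁ ad ∷ E⇒≢ (E↔ wa) ∷ proj₁ (far-sym xa) ∷ []) ∷
       (E⇒≢ bc ∷ proj₁ bd ∷ E⇒≢ (E↔ wb) ∷ E⇒≢ (E↔ xb) ∷ []) ∷
       (E⇒≢ cd ∷ E⇒≢ (E↔ wc) ∷ E⇒≢ (E↔ xc) ∷ []) ∷
       (proj₁ (far-sym wd) ∷ E⇒≢ (E↔ xd) ∷ []) ∷ (E⇒≢ wx ∷ []) ∷ [] ∷ [])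

    v : Fin 4 → V
    v i = Injection.to f (Inverse.from Fin.+↔⊎ (inj₁ i))

    vv : ∀ i j → Next i j → E τ (v i) (v j)
    vv 0F 1F refl = ab
    vv 1F 2F refl = bc
    vv 2F 3F refl = cd

    w₁v : ∀ i → suc (toℕ i) ℕ.< 4 → E σ w (v i)
    w₁v 0F _ = wa
    w₁v 1F _ = wb
    w₁v 2F _ = wc
    w₁v 3F (s≤s (s≤s (s≤s (s≤s ()))))

    w₂v : ∀ i → 0 ℕ.< toℕ i → E σ x (v i)
    w₂v 1F _ = xb
    w₂v 2F _ = xc
    w₂v 3F _ = xd

    vv-only : ∀ i j → T (toℕ i ℕ.<ᵇ toℕ j) → (Next i j ⊎ Next j i) ⊎ ¬ Adj (v i) (v j)
    vv-only 0F 1F _ = inj₁ (inj₁ refl)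
    vv-only 0F 2F _ = inj₂ (proj₂ ac)
    vv-only 0F 3F _ = inj₂ (proj₂ ad)
    vv-only 1F 2F _ = inj₁ (inj₁ refl)
    vv-only 1F 3F _ = inj₂ (proj₂ bd)
    vv-only 2F 3F _ = inj₁ (inj₁ refl)

    w₁v-only : ∀ i → Adj w (v i) → suc (toℕ i) ℕ.< 4
    w₁v-only 0F _ = s≤s (s≤s z≤n)
    w₁v-only 1F _ = s≤s (s≤s (s≤s z≤n))
    w₁v-only 2F _ = s≤s (s≤s (s≤s (s≤s z≤n)))
    w₁v-only 3F e = contradiction e (proj₂ wd)

    w₂v-only : ∀ i → Adj x (v i) → 0 ℕ.< toℕ i
    w₂v-only 0F e = contradiction e (proj₂ xa)
    w₂v-only 1F _ = s≤s z≤n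
    w₂v-only 2F _ = s≤s z≤n
    w₂v-only 3F _ = s≤s z≤n

  -- Existence of sinks.

  below-or-⊂ : ∀ {σ τ v z} → Opp σ τ → E τ v z → N σ v ⊆ N σ z ⊎ N σ z ⊂ N σ v
  below-or-⊂ {σ} {τ} {v} {z} op vz with N? σ v ⊆? N? σ z
  ... | yes v⊆z = inj₁ v⊆z
  ... | no v⊈z with ⊈⇒∃ (N? σ v) (N? σ z) v⊈z
  ...   | x , xv , ¬xz = inj₂ (nested op (E↔ vz) xv ¬xz , v⊈z)

  -- The two kinds of steps, along τ-edges with growing σ-neighbourhood and along
  -- σ-edges with growing τ-neighbourhood, compose to a step of the first kind;
  -- therefore they cannot alternate in a cycle.
  ⊂-compose : ∀ {σ τ v w x} → Opp σ τ → E τ v w → N σ v ⊂ N σ w → E σ w x → N τ w ⊂ N τ x →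
              E τ v x × N σ v ⊂ N σ x
  ⊂-compose op vw v⊂w wx (w⊆x , _) =
    w⊆x vw , nested op (w⊆x vw) wx ¬wv , λ x⊆v → ¬wv (x⊆v wx)
    where
    ¬wv = λ wv → disjoint op wv (E↔ vw)

  -- Only `v` is confined to `S`; the neighbourhoods are taken in the whole graph.
  SinkIn : Pred V 0ℓ → Pred V 0ℓ
  SinkIn S z = ∀ v → S v → ∀ σ → E (opposite σ) v z → N σ v ⊆ N σ z

  sinkIn? : ∀ {S} → Decidable S → Decidable (SinkIn S)
  sinkIn? S? z = all? λ v → S? v →-dec map′
    (λ { (p , m) + → p ; (p , m) - → m }) (λ f → f + , f -)
    ((E? - v z →-dec (N? + v ⊆? N? + z)) ×-dec (E? + v z →-dec (N? - v ⊆? N? - z)))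

  module _ {S : Pred V 0ℓ} (S? : Decidable S) where

    private
      Up : Sign → Rel V 0ℓ
      Up σ v w = S w × E (opposite σ) v w × N σ v ⊂ N σ w

      up? : ∀ σ → Binary.Decidable (Up σ)
      up? σ v w = S? w ×-dec (E? (opposite σ) v w ×-dec (N? σ v ⊂? N? σ w))

      Top : Pred V 0ℓ
      Top v = S v × ¬ ∃ (Up + v)

      top? : Decidable Top
      top? v = S? v ×-dec ¬? (any? (up? + v))

    -- The vertex `t` shows that `Top` is inhabited, and `z` maximises `N -` within `Top`. If `z`
    -- had a step `Up -`, let `w` be a target with maximal `N +`. A step `Up +` from `w` to `x`
    -- would compose to a step `Up -` from `z` to `x`, against the choice of `w`; so `w` is in
    -- `Top`, against the choice of `z`.
    sink-exists : ∃ S → ∃ λ z → S z × SinkIn S z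
    sink-exists ∃S with ⊂-maximal S? (N? +) ∃S
    ... | t , St , t-max with ⊂-maximal top? (N? -) (t , St , λ (w , Sw , _ , t⊂w) → t-max w Sw t⊂w)
    ...   | z , (Sz , ¬up₊) , z-max = z , Sz , sink
      where
      ¬up₋ : ¬ ∃ (Up - z)
      ¬up₋ ∃up with ⊂-maximal (up? - z) (N? +) ∃up
      ... | w , (Sw , zw , z⊂w) , w-max = z-max w (Sw , ¬up) z⊂w
        where
        ¬up : ¬ ∃ (Up + w)
        ¬up (x , Sx , wx , w⊂x) = w-max x (Sx , ⊂-compose refl zw z⊂w wx w⊂x) w⊂x

      sink : SinkIn S z
      sink v Sv + vz = [ (λ v⊆z → v⊆z) , (λ z⊂v → contradiction (v , Sv , E↔ vz , z⊂v) ¬up₊) ]′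
        (below-or-⊂ refl vz)
      sink v Sv - vz = [ (λ v⊆z → v⊆z) , (λ z⊂v → contradiction (v , Sv , E↔ vz , z⊂v) ¬up₋) ]′
        (below-or-⊂ refl vz)

  sink-⊆ : ∀ {S z v σ τ} → SinkIn S z → Opp σ τ → S v → E τ v z → N σ v ⊆ N σ z
  sink-⊆ sink refl Sv vz = sink _ Sv _ vz

  -- Structure around a sink.

  module Sink {σ τ : Sign} (op : Opp σ τ) {y : V} (sink : SinkIn U y) where

    po : Opp τ σ
    po = opp-sym op

    K M Z : Pred V 0ℓ
    K = N σ y
    M = N τ y
    Z t = Far t y

    K-¬τ : ∀ {u v} → K u → K v → ¬ E τ u v
    K-¬τ Ku Kv uv = disjoint op Ku (sink-⊆ sink po _ Kv uv)

    K-link : ∀ {u v} → K u → K v → u ≢ v → E σ u v ⊎ Far u v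
    K-link Ku Kv u≢v with link op u≢v
    ... | inj₁ uv        = inj₁ uv
    ... | inj₂ (inj₁ uv) = contradiction uv (K-¬τ Ku Kv)
    ... | inj₂ (inj₂ uv) = inj₂ uv

    K⇒τ-M : ∀ {u t} → K u → E τ t u → M t
    K⇒τ-M Ku tu = sink-⊆ sink po _ Ku tu

    M⇒σ-K : ∀ {m t} → M m → E σ t m → K t
    M⇒σ-K Mm tm = sink-⊆ sink op _ Mm tm

    KZ-¬τ : ∀ {u z} → K u → Z z → ¬ E τ z u
    KZ-¬τ Ku Zz zu = far⇒¬E Zz (K⇒τ-M Ku zu)

    MZ-¬σ : ∀ {m z} → M m → Z z → ¬ E σ z m
    MZ-¬σ Mm Zz zm = far⇒¬E Zz (M⇒σ-K Mm zm)

    KM-≢ : ∀ {u m} → K u → M m → u ≢ m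
    KM-≢ Ku Mm refl = disjoint op Ku Mm

    KZ-≢ : ∀ {u z} → K u → Z z → u ≢ z
    KZ-≢ Ku Zz refl = far⇒¬E Zz Ku

    MZ-≢ : ∀ {m z} → M m → Z z → m ≢ z
    MZ-≢ Mm Zz refl = far⇒¬E Zz Mm

    -- Two non-adjacent vertices of `Z` would form an independent triple with `y`.
    Z-link : ∀ {z z′} → Z z → Z z′ → z ≢ z′ → E σ z z′ ⊎ E τ z z′
    Z-link Zz Zz′ z≢z′ with link op z≢z′
    ... | inj₁ e        = inj₁ e
    ... | inj₂ (inj₁ e) = inj₂ e
    ... | inj₂ (inj₂ f) = ⊥-elim (no-far-triple f Zz Zz′)

    σ-nbr-of-Z : ∀ {z t} → Z z → E σ t z → K t ⊎ Z t
    σ-nbr-of-Z Zz tz with link op (λ { refl → far⇒¬E Zz (E↔ tz) })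
    ... | inj₁ Kt        = inj₁ Kt
    ... | inj₂ (inj₁ Mt) = contradiction (E↔ tz) (MZ-¬σ Mt Zz)
    ... | inj₂ (inj₂ Zt) = inj₂ Zt

    τ-nbr-of-Z : ∀ {z t} → Z z → E τ t z → M t ⊎ Z t
    τ-nbr-of-Z Zz tz with link op (λ { refl → far⇒¬E Zz (E↔ tz) })
    ... | inj₁ Kt        = contradiction (E↔ tz) (KZ-¬τ Kt Zz)
    ... | inj₂ (inj₁ Mt) = inj₁ Mt
    ... | inj₂ (inj₂ Zt) = inj₂ Zt

    K-alpha : ∀ {u v t} → K u → K v → K t → Far u v → u ≢ t → v ≢ t → E σ t u ⊎ E σ t v
    K-alpha Ku Kv Kt uv u≢t v≢t with K-link Ku Kt u≢t | K-link Kv Kt v≢t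
    ... | inj₁ ut | _       = inj₁ (E↔ ut)
    ... | inj₂ _  | inj₁ vt = inj₂ (E↔ vt)
    ... | inj₂ ut | inj₂ vt = ⊥-elim (no-far-triple uv ut vt)

    -- Otherwise the path `q y m p` has signs σ, τ, σ, and C2 joins `q` to `p`.
    M-¬σ : ∀ {p q m} → K p → K q → Far p q → M m → ¬ E σ m p
    M-¬σ Kp Kq pq Mm mp = far⇒¬E pq (E↔ (path⇒ends op (≢-sym (proj₁ pq)) Kq (E↔ Mm) mp))

    module _ {p q : V} (Kp : K p) (Kq : K q) (pq : Far p q) where

      M-adjacent : ∀ {m} → M m → E τ m p ⊎ E τ m q
      M-adjacent Mm with link op (≢-sym (KM-≢ Kp Mm)) | link op (≢-sym (KM-≢ Kq Mm))
      ... | inj₁ mp         | _              = contradiction mp (M-¬σ Kp Kq pq Mm)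
      ... | inj₂ (inj₁ mp)  | _              = inj₁ mp
      ... | inj₂ (inj₂ _)   | inj₁ mq        = contradiction mq (M-¬σ Kq Kp (far-sym pq) Mm)
      ... | inj₂ (inj₂ _)   | inj₂ (inj₁ mq) = inj₂ mq
      ... | inj₂ (inj₂ mp)  | inj₂ (inj₂ mq) = ⊥-elim (no-far-triple mp mq pq)

      -- If `p` is the vertex τ-joined to `m`, the path `m p y m′` has signs τ, σ, τ, and C2 joins
      -- its ends; likewise for `q`.
      M-clique : ∀ {m m′} → M m → M m′ → m ≢ m′ → E τ m m′
      M-clique Mm Mm′ m≢m′ with M-adjacent Mm
      ... | inj₁ mp = path⇒ends po m≢m′ mp Kp (E↔ Mm′)
      ... | inj₂ mq = path⇒ends po m≢m′ mq Kq (E↔ Mm′)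

      M-far : ∀ {m} → M m → ¬ E τ m p → Far m p
      M-far Mm ¬mp = far op (≢-sym (KM-≢ Kp Mm)) (M-¬σ Kp Kq pq Mm) ¬mp

      -- If `m` misses `p` and `m′` misses `q`, the σ-path `p y q` together with `m′` and `m` is a
      -- hill on five vertices.
      M-full : ∀ {m} → M m → ¬ E τ m p → M ⊆ N τ q
      M-full {m} Mm ¬mp {m′} Mm′ with E? τ m′ q
      ... | yes m′q = m′q
      ... | no ¬m′q with M-adjacent Mm | M-adjacent Mm′
      ...   | inj₁ mp | _ = contradiction mp ¬mp
      ...   | inj₂ _  | inj₂ m′q = contradiction m′q ¬m′q
      ...   | inj₂ mq | inj₁ m′p = ⊥-elim (no-hill₅ po Kp (E↔ Kq) pq
        (M-clique Mm′ Mm λ { refl → ¬mp m′p }) m′p Mm′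
        (far op (≢-sym (KM-≢ Kq Mm′)) (M-¬σ Kq Kp (far-sym pq) Mm′) ¬m′q) (M-far Mm ¬mp) Mm mq)

      Z-adjacent : ∀ {z} → Z z → E σ z p ⊎ E σ z q
      Z-adjacent Zz with link op (≢-sym (KZ-≢ Kp Zz)) | link op (≢-sym (KZ-≢ Kq Zz))
      ... | inj₁ zp        | _              = inj₁ zp
      ... | inj₂ (inj₁ zp) | _              = contradiction zp (KZ-¬τ Kp Zz)
      ... | inj₂ (inj₂ _)  | inj₁ zq        = inj₂ zq
      ... | inj₂ (inj₂ _)  | inj₂ (inj₁ zq) = contradiction zq (KZ-¬τ Kq Zz)
      ... | inj₂ (inj₂ zp) | inj₂ (inj₂ zq) = ⊥-elim (no-far-triple zp zq pq)

      -- Otherwise `y p z q` is an induced 4-cycle of sign σ.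
      Z-not-both : ∀ {z} → Z z → E σ z p → ¬ E σ z q
      Z-not-both Zz zp zq = no-C4 (E↔ Kp) (E↔ zp) zq Kq (far-sym Zz) pq

      -- The edge `zz′` has sign σ or τ. In the first case `y p z z′ q` is an induced 5-cycle; in
      -- the second C2, applied to `p z z′ q`, joins `p` to `q`.
      Z-separated : ∀ {z z′} → Z z → Z z′ → E σ z p → ¬ E σ z′ q
      Z-separated {z} {z′} Zz Zz′ zp z′q
        with Z-link Zz Zz′ (λ { refl → Z-not-both Zz zp z′q })
      ... | inj₁ zz′ = no-C5 (E↔ Kp) (E↔ zp) zz′ z′q Kq (far-sym Zz) (far-sym Zz′)
        (far op (KZ-≢ Kp Zz′) (λ pz′ → Z-not-both Zz′ (E↔ pz′) z′q) (λ pz′ → KZ-¬τ Kp Zz′ (E↔ pz′)))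
        pq
        (far op (≢-sym (KZ-≢ Kq Zz)) (Z-not-both Zz zp) (KZ-¬τ Kq Zz))
      ... | inj₂ zz′ = far⇒¬E pq (path⇒ends op (proj₁ pq) (E↔ zp) zz′ z′q)

    -- Simplicial vertices of `K`.

    Simplicial : Pred V 0ℓ
    Simplicial v = ∀ {p q} → K p → K q → p ≢ q → E σ p v → E σ q v → E σ p q

    Ball : V → Pred V 0ℓ
    Ball v t = K t × (t ≡ v ⊎ E σ t v)

    -- Among the vertices of `K` far from `a`, take `v` with minimal ball. Suppose it has
    -- non-adjacent neighbours `p` and `q` in `K`. If both are adjacent to `a`, there is an induced
    -- 4-cycle `v p a q`; if neither is, `p`, `q`, `a` are independent; if one is, the ball shrinks.
    simplicial-far : ∀ {a} → K a → (∃ λ v → K v × Far v a) → ∃ λ v → K v × Far v a × Simplicial v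
    simplicial-far {a} Ka ∃far
      with ⊂-minimal (λ v → E? σ v y ×-dec far? v a)
                     (λ v t → E? σ t y ×-dec ((t ≟ v) ⊎-dec E? σ t v)) ∃far
    ... | v , (Kv , va) , minimal = v , Kv , va , simplicial
      where
      -- If v had non-adjacent neighbours p and q, with only p adjacent to a, then
      -- the ball of q would be strictly smaller than that of v.
      shrink : ∀ {p q} → K p → K q → Far p q → E σ p v → E σ q v → E σ a p → Far q a → ⊥
      shrink {p} {q} Kp Kq pq pv qv ap qa = minimal q (Kq , qa) (ball , λ v⊆q → outside (v⊆q (Kp , inj₂ pv)))
        where
        outside : ¬ Ball q p
        outside (_ , inj₁ refl) = proj₁ pq refl
        outside (_ , inj₂ e)    = far⇒¬E pq e

        ball : Ball q ⊆ Ball v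
        ball (Kt , inj₁ refl) = Kt , inj₂ qv
        ball {t} (Kt , inj₂ tq) with t ≟ v
        ... | yes t≡v = Kt , inj₁ t≡v
        ... | no t≢v with K-link Kt Kv t≢v
        ...   | inj₁ tv = Kt , inj₂ tv
        -- As `v`, `a`, `t` are not independent, `t` is joined to `a`. Then `v q t p` or `v q t a p`
        -- is an induced cycle, according to whether `t` and `p` are adjacent.
        ...   | inj₂ tv with K-alpha Kv Ka Kt va (≢-sym t≢v) (λ { refl → far⇒¬E qa (E↔ tq) })
        ...     | inj₁ t-v = contradiction t-v (far⇒¬E tv)
        ...     | inj₂ ta with K-link Kt Kp (λ { refl → far⇒¬E pq tq })
        ...       | inj₁ tp = ⊥-elim (no-C4 (E↔ qv) (E↔ tq) tp pv (far-sym tv) (far-sym pq))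
        ...       | inj₂ tp = ⊥-elim (no-C5 (E↔ qv) (E↔ tq) ta ap pv (far-sym tv) va qa (far-sym pq) tp)

      simplicial : Simplicial v
      simplicial Kp Kq p≢q pv qv with K-link Kp Kq p≢q
      ... | inj₁ pq = pq
      ... | inj₂ pq with K-link Kp Ka (λ { refl → far⇒¬E va (E↔ pv) })
                       | K-link Kq Ka (λ { refl → far⇒¬E va (E↔ qv) })
      ...   | inj₁ pa | inj₁ qa = ⊥-elim (no-C4 (E↔ pv) pa (E↔ qa) qv va pq)
      ...   | inj₁ pa | inj₂ qa = ⊥-elim (shrink Kp Kq pq pv qv (E↔ pa) qa)
      ...   | inj₂ pa | inj₁ qa = ⊥-elim (shrink Kq Kp (far-sym pq) qv pv (E↔ qa) pa)
      ...   | inj₂ pa | inj₂ qa = ⊥-elim (no-far-triple pq pa qa)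

    -- Good vertices when `K` is not a clique.

    module _ {a b : V} (Ka : K a) (Kb : K b) (ab : Far a b) where

      -- The σ-neighbours of `b` are `y` and vertices of `K`, since `M-¬σ` excludes `M` and the
      -- second hypothesis excludes `Z`; its τ-neighbours lie in the clique `M`.
      good-in-K : Simplicial b → (∀ {z} → Z z → ¬ E σ z b) → M ⊆ N τ b → Good G b
      good-in-K b-simplicial ¬Zb Mb = record
        { simplicial = λ ρ u v u≢v ub bv → by-sign op
            (λ ρ _ → ∀ {u v} → u ≢ v → E ρ u b → E ρ v b → E ρ u v) simp-σ simp-τ refl u≢v ub (E↔ bv)
        ; dominating = λ u v ρρ′ uv vb → by-sign op
            (λ ρ ρ′ → ∀ {u v} → E ρ u v → E ρ′ v b → E ρ u b) dom-σ dom-τ ρρ′ uv vb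
        }
        where
        σ-nbr : ∀ {t} → E σ t b → t ≡ y ⊎ K t
        σ-nbr {t} tb with t ≟ y
        ... | yes t≡y = inj₁ t≡y
        ... | no t≢y with link op t≢y
        ...   | inj₁ Kt        = inj₂ Kt
        ...   | inj₂ (inj₁ Mt) = contradiction tb (M-¬σ Kb Ka (far-sym ab) Mt)
        ...   | inj₂ (inj₂ Zt) = contradiction tb (¬Zb Zt)

        simp-σ : ∀ {u v} → u ≢ v → E σ u b → E σ v b → E σ u v
        simp-σ u≢v ub vb with σ-nbr ub | σ-nbr vb
        ... | inj₁ refl | inj₁ refl = contradiction refl u≢v
        ... | inj₁ refl | inj₂ Kv   = E↔ Kv
        ... | inj₂ Ku   | inj₁ refl = Ku
        ... | inj₂ Ku   | inj₂ Kv   = b-simplicial Ku Kv u≢v ub vb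

        simp-τ : ∀ {u v} → u ≢ v → E τ u b → E τ v b → E τ u v
        simp-τ u≢v ub vb = M-clique Ka Kb ab (K⇒τ-M Kb ub) (K⇒τ-M Kb vb) u≢v

        dom-σ : ∀ {u v} → E σ u v → E τ v b → E σ u b
        -- The witness is `y`, σ-joined to `b` but not to `v`, which lies in `M`.
        dom-σ uv vb = nested op vb (E↔ Kb) (λ yv → disjoint op (E↔ yv) (K⇒τ-M Kb vb)) uv

        dom-τ : ∀ {u v} → E τ u v → E σ v b → E τ u b
        dom-τ uv vb with σ-nbr vb
        ... | inj₁ refl = Mb uv
        ... | inj₂ Kv   = Mb (K⇒τ-M Kv uv)

      module Opposite {z₀ : V} (Zz₀ : Z z₀) (z₀a : E σ z₀ a)
                      {m₀ : V} (Mm₀ : M m₀) (¬m₀b : ¬ E τ m₀ b) where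

        ¬Zb : ∀ {z} → Z z → ¬ E σ z b
        ¬Zb Zz = Z-separated Ka Kb ab Zz₀ Zz z₀a

        Za : ∀ {z} → Z z → E σ z a
        Za Zz = [ id , (λ zb → contradiction zb (¬Zb Zz)) ]′ (Z-adjacent Ka Kb ab Zz)

        Ma : M ⊆ N τ a
        Ma = M-full Kb Ka (far-sym ab) Mm₀ ¬m₀b

        Z-far-b : ∀ {z} → Z z → Far z b
        Z-far-b Zz = far op (≢-sym (KZ-≢ Kb Zz)) (¬Zb Zz) (KZ-¬τ Kb Zz)

        -- Suppose `z` and `m` are not adjacent. If `m` misses `b`, then `z`, `b`, `m` are
        -- independent. Otherwise the σ-path `b y a z` together with `m` and `m₀` is a hill on six
        -- vertices; here `m₀` is joined to `z` because it misses `b`.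
        ZM : ∀ {z m} → Z z → M m → E τ z m
        ZM {z} {m} Zz Mm with E? τ z m
        ... | yes zm = zm
        ... | no ¬zm = ⊥-elim (split (E? τ m b))
          where
          near : ∀ {m} → M m → ¬ E τ z m → ¬ E τ m b → ⊥
          near Mm ¬zm ¬mb = no-far-triple (Z-far-b Zz)
            (far op (≢-sym (MZ-≢ Mm Zz)) (MZ-¬σ Mm Zz) ¬zm)
            (far-sym (M-far Kb Ka (far-sym ab) Mm ¬mb))

          split : Dec (E τ m b) → ⊥
          split (no ¬mb) = near Mm ¬zm ¬mb
          split (yes mb) = no-hill₆ po Kb (E↔ Ka) (E↔ (Za Zz)) (far-sym ab) (far-sym (Z-far-b Zz)) (far-sym Zz)
            (M-clique Ka Kb ab Mm Mm₀ (λ { refl → ¬m₀b mb })) mb Mm (Ma Mm)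
            (far op (MZ-≢ Mm Zz) (λ mz → MZ-¬σ Mm Zz (E↔ mz)) (λ mz → ¬zm (E↔ mz)))
            (M-far Kb Ka (far-sym ab) Mm₀ ¬m₀b) Mm₀ (Ma Mm₀)
            (decidable-stable (E? τ m₀ z) (λ ¬m₀z → near Mm₀ (λ zm₀ → ¬m₀z (E↔ zm₀)) ¬m₀b))

        K-nbrs-of-Z : ∀ {p p′ z z′} → K p → K p′ → Z z → Z z′ → E σ z p → E σ z′ p′ → p ≢ p′ → E σ p p′
        K-nbrs-of-Z Kp Kp′ Zz Zz′ zp z′p′ p≢p′ with K-link Kp Kp′ p≢p′
        ... | inj₁ pp′ = pp′
        ... | inj₂ pp′ = contradiction z′p′ (Z-separated Kp Kp′ pp′ Zz Zz′ zp)

        -- Minimality is used only for a pair of σ-neighbours with one in `K` and one in `Z`. The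
        -- other cases follow from `K-nbrs-of-Z`, `M-clique`, `ZM`, `nested` and the sink property
        -- within `Z`.
        good-in-Z : ∃ λ z → Good G z
        good-in-Z
          with ⊂-minimal (λ z → far? z y ×-dec sinkIn? (λ t → far? t y) z)
                         (λ z t → E? σ t y ×-dec E? σ t z)
                         (sink-exists (λ t → far? t y) (z₀ , Zz₀))
        ... | z , (Zz , z-sink) , minimal = z , record
          { simplicial = λ ρ u v u≢v uz zv → by-sign op
              (λ ρ _ → ∀ {u v} → u ≢ v → E ρ u z → E ρ v z → E ρ u v) simp-σ simp-τ refl u≢v uz (E↔ zv)
          ; dominating = λ u v ρρ′ uv vz → by-sign op
              (λ ρ ρ′ → ∀ {u v} → E ρ u v → E ρ′ v z → E ρ u z) dom-σ dom-τ ρρ′ uv vz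
          }
          where
          -- A failing pair p, q would make q another sink of Z, with fewer
          -- neighbours in K than z.
          module _ {p q : V} (Kp : K p) (Zq : Z q) (pz : E σ p z) (qz : E σ q z) (¬pq : ¬ E σ p q) where

            τq⊆τz : N τ q ⊆ N τ z
            τq⊆τz = sink-⊆ z-sink po Zq qz

            -- For `t` in `Z`, a σ-edge `tq` would make `p z t q` a path with signs σ, τ, σ, and C2
            -- would give the excluded edge `pq`.
            τz⊆τq : N τ z ⊆ N τ q
            τz⊆τq tz with τ-nbr-of-Z Zz tz
            ... | inj₁ Mt = E↔ (ZM Zq Mt)
            ... | inj₂ Zt with Z-link Zt Zq (λ { refl → disjoint op qz tz })
            ...   | inj₂ tq = tq
            ...   | inj₁ tq = contradiction
              (path⇒ends op (KZ-≢ Kp Zq) pz (E↔ tz) tq) ¬pq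

            -- As `z` and `q` have equal τ-neighbourhoods, σ-edges at `q` reduce to the sink
            -- property of `z`. For τ-edges `z` itself is the witness in `nested`.
            q-sink : SinkIn Z q
            q-sink v Zv _ vq = by-sign op
              (λ ρ ρ′ → E ρ′ v q → N ρ v ⊆ N ρ q) τ-edge σ-edge refl vq
              where
              τ-edge : E τ v q → N σ v ⊆ N σ q
              τ-edge vq = nested op vq (E↔ qz) (λ zv → disjoint op (E↔ zv) (τq⊆τz vq))

              σ-edge : E σ v q → N τ v ⊆ N τ q
              σ-edge vq with v ≟ z
              ... | yes refl = τz⊆τq
              ... | no v≢z with Z-link Zv Zz v≢z
              ...   | inj₁ vz = τz⊆τq ∘ sink-⊆ z-sink po Zv vz
              ...   | inj₂ vz = contradiction (τz⊆τq vz) (disjoint op vq)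

            -- Otherwise `p z q p′` is an induced 4-cycle, closed by `K-nbrs-of-Z`.
            K-nbr-of-q : ∀ {p′} → K p′ → E σ p′ q → E σ p′ z
            K-nbr-of-q {p′} Kp′ p′q = decidable-stable (E? σ p′ z) λ ¬p′z →
              no-C4 pz (E↔ qz) (E↔ p′q)
                (E↔ (K-nbrs-of-Z Kp Kp′ Zz Zq (E↔ pz) (E↔ p′q) λ { refl → ¬pq p′q }))
                (far op (KZ-≢ Kp Zq) ¬pq (λ pq → KZ-¬τ Kp Zq (E↔ pq)))
                (far op (≢-sym (KZ-≢ Kp′ Zz)) (λ zp′ → ¬p′z (E↔ zp′)) (KZ-¬τ Kp′ Zz))

            not-minimal : ⊥
            not-minimal = minimal q (Zq , q-sink)
              ( (λ (Kt , tq) → Kt , K-nbr-of-q Kt tq)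
              , λ z⊆q → ¬pq (proj₂ (z⊆q (Kp , pz))) )

          mixed : ∀ {p q} → K p → Z q → E σ p z → E σ q z → E σ p q
          mixed Kp Zq pz qz = decidable-stable (E? σ _ _) (not-minimal Kp Zq pz qz)

          simp-σ : ∀ {u v} → u ≢ v → E σ u z → E σ v z → E σ u v
          simp-σ u≢v uz vz with σ-nbr-of-Z Zz uz | σ-nbr-of-Z Zz vz
          ... | inj₁ Ku | inj₁ Kv = K-nbrs-of-Z Ku Kv Zz Zz (E↔ uz) (E↔ vz) u≢v
          ... | inj₁ Ku | inj₂ Zv = mixed Ku Zv uz vz
          ... | inj₂ Zu | inj₁ Kv = E↔ (mixed Kv Zu vz uz)
          ... | inj₂ Zu | inj₂ Zv with Z-link Zu Zv u≢v
          ...   | inj₁ uv = uv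
          ...   | inj₂ uv = contradiction (sink-⊆ z-sink po Zv vz uv) (disjoint op uz)

          simp-τ : ∀ {u v} → u ≢ v → E τ u z → E τ v z → E τ u v
          simp-τ u≢v uz vz with τ-nbr-of-Z Zz uz | τ-nbr-of-Z Zz vz
          ... | inj₁ Mu | inj₁ Mv = M-clique Ka Kb ab Mu Mv u≢v
          ... | inj₁ Mu | inj₂ Zv = E↔ (ZM Zv Mu)
          ... | inj₂ Zu | inj₁ Mv = ZM Zu Mv
          ... | inj₂ Zu | inj₂ Zv with Z-link Zu Zv u≢v
          ...   | inj₁ uv = contradiction uz (disjoint op (sink-⊆ z-sink op Zv vz uv))
          ...   | inj₂ uv = uv

          dom-σ : ∀ {u v} → E σ u v → E τ v z → E σ u z
          dom-σ uv vz with τ-nbr-of-Z Zz vz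
          -- The witness is `a`, which is σ-joined to `z` and τ-joined to `v`.
          ... | inj₁ Mv = nested op vz (E↔ (Za Zz)) (λ av → disjoint op av (E↔ (Ma Mv))) uv
          ... | inj₂ Zv = sink-⊆ z-sink op Zv vz uv

          dom-τ : ∀ {u v} → E τ u v → E σ v z → E τ u z
          dom-τ uv vz with σ-nbr-of-Z Zz vz
          ... | inj₁ Kv = E↔ (ZM Zz (K⇒τ-M Kv uv))
          ... | inj₂ Zv = sink-⊆ z-sink po Zv vz uv

    good-beyond : ∀ {a b z} → K a → K b → Far a b → Simplicial b → Z z → E σ z a → ∃ (Good G)
    good-beyond {a} {b} Ka Kb ab b-simplicial Zz za with any? (λ m → E? τ m y ×-dec ¬? (E? τ m b))
    ... | yes (m , Mm , ¬mb) = Opposite.good-in-Z Ka Kb ab Zz za Mm ¬mb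
    ... | no ¬∃ = b , good-in-K Ka Kb ab b-simplicial
      (λ Zz′ → Z-separated Ka Kb ab Zz Zz′ za)
      (λ {m} Mm → decidable-stable (E? τ m b) λ ¬mb → ¬∃ (m , Mm , ¬mb))

    good-nearby : ∀ {p q} → K p → K q → Far p q → ∃ (Good G)
    -- Two applications yield non-adjacent simplicial vertices: `b` far from `q`, then `a` far from
    -- `b`.
    good-nearby {p} {q} Kp Kq pq with simplicial-far Kq (p , Kp , pq)
    ... | b , Kb , bq , b-simplicial with simplicial-far Kb (q , Kq , far-sym bq)
    ...   | a , Ka , ab , a-simplicial with any? (λ z → far? z y)
    ...     | yes (z , Zz) = [ good-beyond Ka Kb ab b-simplicial Zz
                             , good-beyond Kb Ka (far-sym ab) a-simplicial Zz ]′ (Z-adjacent Ka Kb ab Zz)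
    ...     | no ¬Z with any? (λ m → E? τ m y ×-dec ¬? (E? τ m a))
    ...       | no ¬∃ = a , good-in-K Kb Ka (far-sym ab) a-simplicial (λ Zz _ → ¬Z (_ , Zz))
      (λ {m} Mm → decidable-stable (E? τ m a) λ ¬ma → ¬∃ (m , Mm , ¬ma))
    ...       | yes (m , Mm , ¬ma) = b , good-in-K Ka Kb ab b-simplicial (λ Zz _ → ¬Z (_ , Zz))
      (M-full Ka Kb ab Mm ¬ma)

  good-exists : V → ∃ (Good G)
  good-exists x with sink-exists U? (x , _)
  ... | y , _ , sink with any? (far-pair? +) | any? (far-pair? -)
    where
    FarPair : Sign → Pred V 0ℓ
    FarPair σ p = ∃ λ q → E σ p y × E σ q y × Far p q

    far-pair? : ∀ σ → Decidable (FarPair σ)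
    far-pair? σ p = any? λ q → E? σ p y ×-dec (E? σ q y ×-dec far? p q)
  ...   | yes (p , q , Kp , Kq , pq) | _ = Sink.good-nearby refl sink Kp Kq pq
  ...   | no _ | yes (p , q , Kp , Kq , pq) = Sink.good-nearby refl sink Kp Kq pq
  -- Both neighbourhoods of the sink are cliques, so the sink itself is good.
  ...   | no ¬₊ | no ¬₋ = y , record
    { simplicial = λ
      { + u v u≢v uy yv → [ id , (λ uv → ⊥-elim (¬₊ (u , v , uy , E↔ yv , uv))) ]′
          (Sink.K-link refl sink uy (E↔ yv) u≢v)
      ; - u v u≢v uy yv → [ id , (λ uv → ⊥-elim (¬₋ (u , v , uy , E↔ yv , uv))) ]′
          (Sink.K-link refl sink uy (E↔ yv) u≢v)
      }
    ; dominating = λ u v op uv vy → sink-⊆ sink op _ vy uv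
    }

-- Sufficiency: building the ordering by induction.

module Induced (G : SignedGraph) {k : ℕ} (f : Fin k ↣ SignedGraph.V G) where

  private
    H : SignedGraph
    H = induced G f

  open Injection f using (injective)

  noIndependentTriple : NoIndependentTriple G → NoIndependentTriple H
  noIndependentTriple α u v w uniq = α _ _ _ (Unique-map⁺ injective uniq)

  c2 : C2 G → C2 H
  c2 c2 σ u v w x uniq = c2 σ _ _ _ _ (Unique-map⁺ injective uniq)

  i1 : I1 G → I1 H
  i1 i1 σ n n≡ c (cycle , record { isCycle = isCycle ; chordless = chordless }) =
    i1 σ n n≡ (f ↣-∘ c) (transfer cycle , record { isCycle = transfer isCycle ; chordless = chordless })
    where
    transfer : {R : Rel (SignedGraph.V G) 0ℓ} →
               IsCycle (R on Injection.to f) c → IsCycle R (f ↣-∘ c)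
    transfer record { length≥3 = length≥3 ; edges = edges } =
      record { length≥3 = length≥3 ; edges = edges }

  i2 : I2 G → I2 H
  i2 i2 n n≡ g = i2 n n≡ (f ↣-∘ g)

-- The size `n` is a variable rather than the field `order G`, so that the induction can match on
-- it.
record Eliminates (G : SignedGraph) {n : ℕ} (ν : SignedGraph.V G ↔ Fin n) : Set where
  open SignedGraph G
  open Inverse ν using () renaming (to to pos)
  field
    simplicial : ∀ σ u v w → u ≢ v → pos u < pos w → pos v < pos w → E σ u w → E σ w v → E σ u v
    dominating : ∀ {σ τ} u v w → Opp σ τ → pos u < pos w → pos v < pos w →
                 E σ u v → E τ v w → E σ u w

module PutLast (G : SignedGraph) {k : ℕ} (fin : SignedGraph.V G ↔ Fin (suc k)) (w : SignedGraph.V G)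
               (good : Good G w) where
  open SignedGraph G
  open Inverse fin using (to; from; strictlyInverseˡ; strictlyInverseʳ)
  open Finite fin using (_≟_)

  rest : Fin k ↣ V
  rest = ↔⇒↣ (↔-sym fin) ↣-∘ mk↣ (Fin.punchIn-injective (to w) _ _)

  private
    rest-onto : ∀ {x} → x ≢ w → ∃ λ j → Injection.to rest j ≡ x
    rest-onto {x} x≢w = punchOut w≢x ,
      trans (cong from (Fin.punchIn-punchOut w≢x)) (strictlyInverseʳ x)
      where
      w≢x : to w ≢ to x
      w≢x eq = x≢w (sym (Injection.injective (↔⇒↣ fin) eq))

  module _ {ν : Fin k ↔ Fin k} (el : Eliminates (induced G rest) ν) where

    -- `fromℕ k` is the last position; the other vertices keep the relative order given by `ν`.
    ordering : V ↔ Fin (suc k)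
    ordering = Permutation.insert (to w) (fromℕ k) ν ↔-∘ fin

    private
      pos : V → Fin (suc k)
      pos = Inverse.to ordering

      pos-w : pos w ≡ fromℕ k
      pos-w with to w Fin.≟ to w
      ... | yes _ = refl
      ... | no ¬r = contradiction refl ¬r

      pos-rest : ∀ j → pos (Injection.to rest j) ≡ punchIn (fromℕ k) (Inverse.to ν j)
      pos-rest j = trans
        (cong (Inverse.to (Permutation.insert (to w) (fromℕ k) ν)) (strictlyInverseˡ (punchIn (to w) j)))
        (Permutation.insert-punchIn (to w) (fromℕ k) ν j)

      pos-cancel-< : ∀ i j → pos (Injection.to rest i) < pos (Injection.to rest j) →
                     Inverse.to ν i < Inverse.to ν j
      pos-cancel-< i j lt = ℕ.≰⇒> λ ge → ℕ.<⇒≱ lt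
        (subst₂ (λ a b → toℕ a ℕ.≤ toℕ b) (sym (pos-rest j)) (sym (pos-rest i))
          (Fin.punchIn-mono-≤ (fromℕ k) _ _ ge))

      <⇒≢w : ∀ {u x} → pos u < pos x → u ≢ w
      <⇒≢w {x = x} lt refl = ℕ.<⇒≱ lt (subst (λ i → toℕ (pos x) ℕ.≤ toℕ i) (sym pos-w) (Fin.≤fromℕ (pos x)))

    eliminates : Eliminates G ordering
    eliminates = record { simplicial = simp ; dominating = dom }
      where
      simp : ∀ σ u v x → u ≢ v → pos u < pos x → pos v < pos x → E σ u x → E σ x v → E σ u v
      simp σ u v x u≢v u<x v<x with x ≟ w
      ... | yes refl = Good.simplicial good σ u v u≢v
      ... | no x≢w with rest-onto x≢w | rest-onto (<⇒≢w u<x) | rest-onto (<⇒≢w v<x)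
      ...   | c , refl | a , refl | b , refl = Eliminates.simplicial el σ a b c (u≢v ∘ cong _)
        (pos-cancel-< a c u<x) (pos-cancel-< b c v<x)

      dom : ∀ {σ τ} u v x → Opp σ τ → pos u < pos x → pos v < pos x → E σ u v → E τ v x → E σ u x
      dom u v x op u<x v<x with x ≟ w
      ... | yes refl = Good.dominating good u v op
      ... | no x≢w with rest-onto x≢w | rest-onto (<⇒≢w u<x) | rest-onto (<⇒≢w v<x)
      ...   | c , refl | a , refl | b , refl = Eliminates.dominating el a b c op
        (pos-cancel-< a c u<x) (pos-cancel-< b c v<x)

eliminable : ∀ n (G : SignedGraph) → (fin : SignedGraph.V G ↔ Fin n) →
             NoIndependentTriple G → C2 G → I1 G → I2 G →
             ∃ λ (ν : SignedGraph.V G ↔ Fin n) → Eliminates G ν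
eliminable zero G fin α c2 i1 i2 = fin , record
  { simplicial = λ σ u → contradiction (Inverse.to fin u) Fin.¬Fin0
  ; dominating = λ u → contradiction (Inverse.to fin u) Fin.¬Fin0
  }
eliminable (suc k) G fin α c2 i1 i2 with Conditions.good-exists G α c2 i1 i2 (Inverse.from fin zero)
... | w , good = PutLast.ordering G fin w good el , PutLast.eliminates G fin w good el
  where
  rest : Fin k ↣ SignedGraph.V G
  rest = PutLast.rest G fin w good

  rec = eliminable k (induced G rest) (↔-id (Fin k)) (Induced.noIndependentTriple G rest α)
          (Induced.c2 G rest c2) (Induced.i1 G rest i1) (Induced.i2 G rest i2)

  el : Eliminates (induced G rest) (proj₁ rec)
  el = proj₂ rec

eliminates⇒seo : ∀ {G} {ν : Ordering G} → Eliminates G ν → IsSEO G ν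
eliminates⇒seo el = record
  { E1 = λ { σ u v w ((u≢v ∷ _) ∷ _) u<w v<w → Eliminates.simplicial el σ u v w u≢v u<w v<w }
  ; E2 = λ σ u v w _ u<w v<w → Eliminates.dominating el u v w refl u<w v<w
  }

-- Necessity of the three conditions.

cyclicNext? : ∀ {k} → Binary.Decidable (CyclicNext {k})
cyclicNext? i j = (toℕ j ℕ.≟ suc (toℕ i)) ⊎-dec ((suc (toℕ i) ℕ.≟ _) ×-dec (toℕ j ℕ.≟ 0))

-- Domination at v_1 would join it to `w₂`, and at v_n to `w₁`. An inner v_i would need its two
-- neighbours on the path to be adjacent. Simpliciality at `w₁` would join `w₂` to v_1, and at `w₂`
-- it would join `w₁` to v_n.
hill⇒¬good : ∀ {H} → Hill H → ∀ x → ¬ Good H x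
hill⇒¬good {H} record
  { σ = σ ; n = suc (suc m) ; n≥2 = s≤s (s≤s z≤n) ; enumeration = enumeration
  ; vv = vv ; w₁w₂ = w₁w₂ ; w₁v = w₁v ; w₂v = w₂v
  ; vv-only = vv-only ; w₁v-only = w₁v-only ; w₂v-only = w₂v-only } x good =
  absurd (Inverse.from enumeration x)
    (subst (Good H) (sym (Inverse.strictlyInverseˡ enumeration x)) good)
  where
  open SignedGraph H
  open Inverse enumeration using (to)

  to-injective : ∀ {a b} → to a ≡ to b → a ≡ b
  to-injective = Injection.injective (↔⇒↣ enumeration)

  absurd : ∀ a → ¬ Good H (to a)
  absurd (inj₁ zero) good = ℕ.<-irrefl refl
    (w₂v-only 0F (σ , Good.dominating good _ _ refl (w₂v 1F (s≤s z≤n)) (E-sym _ (vv 0F 1F refl))))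
  absurd (inj₁ (suc j)) good with suc (toℕ (suc j)) ℕ.<? suc (suc m)
  ... | no i≮ = i≮ (w₁v-only (suc j) (σ , Good.dominating good _ _ refl
    (w₁v (inject₁ j) (subst (λ k → suc k ℕ.< suc (suc m)) (sym (Fin.toℕ-inject₁ j)) (Fin.toℕ<n (suc j))))
    (vv (inject₁ j) (suc j) (cong suc (sym (Fin.toℕ-inject₁ j))))))
  ... | yes i< = [ distinct-next , distinct-prev ]′ (vv-only prev next (opposite σ ,
    Good.simplicial good (opposite σ) (to (inj₁ prev)) (to (inj₁ next))
      (λ eq → prev≢next (inj₁-injective (to-injective eq)))
      (vv prev (suc j) (cong suc (sym (Fin.toℕ-inject₁ j)))) (vv (suc j) next toℕ-next)))
    where
    prev next : Fin (suc (suc m))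
    prev = inject₁ j
    next = fromℕ< i<

    toℕ-next : toℕ next ≡ suc (suc (toℕ j))
    toℕ-next = Fin.toℕ-fromℕ< i<

    prev<next : suc (toℕ prev) ℕ.< toℕ next
    prev<next = subst₂ (λ a b → suc a ℕ.< b) (sym (Fin.toℕ-inject₁ j)) (sym toℕ-next) (ℕ.n<1+n _)

    prev≢next : prev ≢ next
    prev≢next eq = ℕ.<⇒≢ (ℕ.<-trans (ℕ.n<1+n _) prev<next) (cong toℕ eq)

    distinct-next : ¬ Next prev next
    distinct-next eq = ℕ.<⇒≢ prev<next (sym eq)

    distinct-prev : ¬ Next next prev
    distinct-prev eq = ℕ.<-asym (ℕ.<-trans (ℕ.n<1+n _) prev<next) (subst (toℕ next ℕ.<_) (sym eq) (ℕ.n<1+n _))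
  absurd (inj₂ 0F) good = ℕ.<-irrefl refl
    (w₂v-only 0F (σ , Good.simplicial good σ _ _ (λ eq → contradiction (to-injective eq) λ ())
      (E-sym _ w₁w₂) (w₁v 0F (s≤s (s≤s z≤n)))))
  absurd (inj₂ 1F) good = ℕ.<-irrefl (cong suc (Fin.toℕ-fromℕ (suc m)))
    (w₁v-only (fromℕ (suc m)) (σ , Good.simplicial good σ _ _ (λ eq → contradiction (to-injective eq) λ ())
      w₁w₂ (w₂v (fromℕ (suc m)) (s≤s z≤n))))

module Forward (G : SignedGraph) (ν : Ordering G) (seo : IsSEO G ν) where
  open SignedGraph G
  open Inverse ν using () renaming (to to pos)
  open IsSEO seo

  -- The vertex of the image with the largest position is good in the induced subgraph. So it is
  -- enough to refute goodness, or to exploit it, at every vertex of a small configuration.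
  last-good : ∀ {k} (f : Fin (suc k) ↣ V) → ∃ (Good (induced G f))
  last-good {k} f with Finite.maximal (↔-id (Fin (suc k))) U?
                         (λ i j → pos (to i) Fin.<? pos (to j)) ℕ.<-trans (ℕ.<-irrefl refl) (zero , _)
    where open Injection f using (to)
  ... | l , _ , l-max = l , record
    { simplicial = λ σ i j i≢j il lj →
        E1 σ _ _ _ (unique i≢j (≢l il) (≢-sym (≢l lj))) (before (≢l il)) (before (≢-sym (≢l lj))) il lj
    ; dominating = λ { i j refl ij jl → E2 _ _ _ _
        (unique (λ { refl → E-irrefl _ _ ij }) (λ { refl → E-disjoint _ (E-sym _ ij) jl }) (≢l jl))
        (before λ { refl → E-disjoint _ (E-sym _ ij) jl }) (before (≢l jl)) ij jl }
    }
    where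
    open Injection f using (to; injective)

    ≢l : ∀ {σ i j} → E σ (to i) (to j) → i ≢ j
    ≢l e refl = E-irrefl _ _ e

    before : ∀ {i} → i ≢ l → pos (to i) < pos (to l)
    before {i} i≢l = Fin.≤∧≢⇒< (ℕ.≮⇒≥ (l-max i _))
      (i≢l ∘ injective ∘ Injection.injective (↔⇒↣ ν))

    unique : ∀ {i j m} → i ≢ j → i ≢ m → j ≢ m → List-Unique (to i ∷ to j ∷ to m ∷ [])
    unique i≢j i≢m j≢m =
      ((i≢j ∘ injective) ∷ (i≢m ∘ injective) ∷ []) ∷ ((j≢m ∘ injective) ∷ []) ∷ [] ∷ []

  c2 : C2 G
  c2 σ u v w x ((u≢v ∷ u≢w ∷ u≢x ∷ []) ∷ (v≢w ∷ v≢x ∷ []) ∷ (w≢x ∷ []) ∷ _) uv vw wx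
    = by-last (proj₁ last) (Good.simplicial (proj₂ last)) (Good.dominating (proj₂ last))
    where
    op = opp-sym {σ} refl

    at : Fin 4 → V
    at = lookup (u ∷ v ∷ w ∷ x ∷ [])

    last = last-good (tuple {xs = u ∷ v ∷ w ∷ x ∷ []}
      ((u≢v ∷ u≢w ∷ u≢x ∷ []) ∷ (v≢w ∷ v≢x ∷ []) ∷ (w≢x ∷ []) ∷ [] ∷ []))

    -- In each case E2 carries edges over to the last vertex, and E1 then joins two of its
    -- σ-neighbours.
    by-last : ∀ l →
      (∀ σ i j → i ≢ j → E σ (at i) (at l) → E σ (at l) (at j) → E σ (at i) (at j)) →
      (∀ {σ τ} i j → Opp σ τ → E σ (at i) (at j) → E τ (at j) (at l) → E σ (at i) (at l)) →
      (E σ u w × E σ u x) ⊎ (E σ u x × E σ v x)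
    by-last 0F simp dom =
      let wu = dom 2F 1F op (E-sym _ vw) (E-sym _ uv)
          xu = dom 3F 2F refl (E-sym _ wx) wu
      in inj₂ (E-sym _ xu , simp σ 1F 3F (λ ()) (E-sym _ uv) (E-sym _ xu))
    by-last 1F simp dom =
      let xv = dom 3F 2F refl (E-sym _ wx) (E-sym _ vw)
      in inj₂ (simp σ 0F 3F (λ ()) uv (E-sym _ xv) , E-sym _ xv)
    by-last 2F simp dom =
      let uw = dom 0F 1F refl uv vw
      in inj₁ (uw , simp σ 0F 3F (λ ()) uw wx)
    by-last 3F simp dom =
      let vx = dom 1F 2F op vw wx
          ux = dom 0F 1F refl uv vx
      in inj₁ (simp σ 0F 2F (λ ()) ux (E-sym _ wx) , ux)

  i1 : I1 G
  i1 σ .4 (inj₁ refl) c (cycle , induced-cycle) = absurd (proj₁ last) (Good.simplicial (proj₂ last) σ)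
    where
    last = last-good c

    open Injection c using (to)
    open IsCycle cycle using (edges)

    -- The implicit arguments are filled by evaluating `cyclicNext?` at concrete positions. Below,
    -- E1 at the last vertex joins its two neighbours on the cycle by such a chord.
    chord : ∀ i j {_ : False (cyclicNext? i j)} {_ : False (cyclicNext? j i)} → ¬ E σ (to i) (to j)
    chord i j {ij} {ji} e =
      [ toWitnessFalse ij , toWitnessFalse ji ]′ (IsInducedCycle.chordless induced-cycle i j (σ , e))

    absurd : ∀ l → ¬ (∀ i j → i ≢ j → E σ (to i) (to l) → E σ (to l) (to j) → E σ (to i) (to j))
    absurd 0F s = chord 3F 1F (s 3F 1F (λ ()) (edges 3F 0F (inj₂ (refl , refl))) (edges 0F 1F (inj₁ refl)))
    absurd 1F s = chord 0F 2F (s 0F 2F (λ ()) (edges 0F 1F (inj₁ refl)) (edges 1F 2F (inj₁ refl)))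
    absurd 2F s = chord 1F 3F (s 1F 3F (λ ()) (edges 1F 2F (inj₁ refl)) (edges 2F 3F (inj₁ refl)))
    absurd 3F s = chord 2F 0F (s 2F 0F (λ ()) (edges 2F 3F (inj₁ refl)) (edges 3F 0F (inj₂ (refl , refl))))
  i1 σ .5 (inj₂ refl) c (cycle , induced-cycle) = absurd (proj₁ last) (Good.simplicial (proj₂ last) σ)
    where
    last = last-good c

    open Injection c using (to)
    open IsCycle cycle using (edges)

    chord : ∀ i j {_ : False (cyclicNext? i j)} {_ : False (cyclicNext? j i)} → ¬ E σ (to i) (to j)
    chord i j {ij} {ji} e =
      [ toWitnessFalse ij , toWitnessFalse ji ]′ (IsInducedCycle.chordless induced-cycle i j (σ , e))

    absurd : ∀ l → ¬ (∀ i j → i ≢ j → E σ (to i) (to l) → E σ (to l) (to j) → E σ (to i) (to j))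
    absurd 0F s = chord 4F 1F (s 4F 1F (λ ()) (edges 4F 0F (inj₂ (refl , refl))) (edges 0F 1F (inj₁ refl)))
    absurd 1F s = chord 0F 2F (s 0F 2F (λ ()) (edges 0F 1F (inj₁ refl)) (edges 1F 2F (inj₁ refl)))
    absurd 2F s = chord 1F 3F (s 1F 3F (λ ()) (edges 1F 2F (inj₁ refl)) (edges 2F 3F (inj₁ refl)))
    absurd 3F s = chord 2F 4F (s 2F 4F (λ ()) (edges 2F 3F (inj₁ refl)) (edges 3F 4F (inj₁ refl)))
    absurd 4F s = chord 3F 0F (s 3F 0F (λ ()) (edges 3F 4F (inj₁ refl)) (edges 4F 0F (inj₂ (refl , refl))))

  i2 : I2 G
  i2 .5 (inj₁ refl) f hill = hill⇒¬good hill (proj₁ (last-good f)) (proj₂ (last-good f))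
  i2 .6 (inj₂ refl) f hill = hill⇒¬good hill (proj₁ (last-good f)) (proj₂ (last-good f))

proposition6p3 : (G : SignedGraph) → NoIndependentTriple G →
    SignedEliminable G ⇔ (C2 G × I1 G × I2 G)
proposition6p3 G α = mk⇔
  (λ (ν , seo) → Forward.c2 G ν seo , Forward.i1 G ν seo , Forward.i2 G ν seo)
  (λ (c2 , i1 , i2) → map₂ eliminates⇒seo (eliminable _ G (SignedGraph.finite G) α c2 i1 i2))
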